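{- Let $G$ be a $(2K_2, C_4)$-free graph on $n$ vertices and let $\ell \ge \chi(G)+1$ be an integer. Then $\mathcal{R}_\ell(G)$ is connected and has diameter at most $4n$.
   Context: All graphs are finite and simple. A $k$-colouring of $G$ is a map $\alpha: V(G)\to\{1,\dots,k\}$ with $\alpha(u)\neq\alpha(v)$ for every edge $uv$; $\chi(G)$ is the chromatic number. The reconfiguration graph $\mathcal{R}_k(G)$ has the $k$-colourings of $G$ as vertices, two being adjacent if they differ on exactly one vertex. A graph is $(H_1,H_2)$-free if it has no induced subgraph isomorphic to $H_1$ or $H_2$; $2K_2$ is the disjoint union of two edges and $C_4$ is the 4-cycle. -}

module Defs where

open import Data.Fin using (Fin; finToFun; funToFin)
open import Data.Fin.Patterns
open import Data.Fin.Properties using (_≟_; all?; any?; finToFun-funToFin)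
open import Data.Nat using (ℕ; zero; suc; _≤_; z≤n; s≤s; _^_)
open import Data.Product using (_×_; _,_; proj₁; ∃; ∃-syntax; ∃!)
open import Function using (id; _∘_; _⇔_)
open import Function.Definitions using (Injective)
open import Level using (0ℓ)
open import Relation.Binary using (Rel; Setoid; Symmetric; Irreflexive; Decidable; _Respects₂_)
import Relation.Binary.Construct.On as On
open import Relation.Binary.Construct.Closure.Symmetric using (SymClosure; fwd; bwd; symmetric)
open import Relation.Binary.PropositionalEquality using (_≡_; _≢_; refl; sym; trans; setoid; resp₂; _→-setoid_)
open import Relation.Nullary using (¬_; Dec; yes; no; contradiction)
open import Relation.Nullary.Decidable using (map′; _→-dec_; ¬?)
import Relation.Unary as U

-- Simple graphs on a setoid of vertices: the vertices of a reconfiguration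
-- graph are functions, which must be compared pointwise.

record Graph (V : Setoid 0ℓ 0ℓ) : Set₁ where
  open Setoid V using (_≈_) renaming (Carrier to Vertex)
  field
    Adj        : Rel Vertex 0ℓ
    Adj-resp   : Adj Respects₂ _≈_
    Adj-sym    : Symmetric Adj
    Adj-irrefl : Irreflexive _≈_ Adj

module _ {V : Setoid 0ℓ 0ℓ} (G : Graph V) where
  open Setoid V using (_≈_) renaming (Carrier to Vertex)
  open Graph G

  data Walk : Vertex → Vertex → ℕ → Set where
    stop : ∀ {u v} → u ≈ v → Walk u v 0
    step : ∀ {u w v k} → Adj u w → Walk w v k → Walk u v (suc k)

  Connected : Set
  Connected = Vertex × (∀ u v → ∃[ k ] Walk u v k)

  IsDistance : Vertex → Vertex → ℕ → Set
  IsDistance u v d = Walk u v d × (∀ {k} → Walk u v k → d ≤ k)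

  DiameterAtMost : ℕ → Set
  DiameterAtMost m = ∀ u v → ∃[ d ] (IsDistance u v d × d ≤ m)

-- Finite simple graphs on n vertices.  Adjacency is required to be decidable,
-- which classically is no restriction.

record FinGraph (n : ℕ) : Set₁ where
  field
    graph : Graph (setoid (Fin n))
  open Graph graph public
  field
    Adj? : Decidable Adj

record _InducedSubgraphOf_ {m n} (H : FinGraph m) (G : FinGraph n) : Set where
  private
    module H = FinGraph H
    module G = FinGraph G
  field
    embed           : Fin m → Fin n
    embed-injective : Injective _≡_ _≡_ embed
    embed-adj       : ∀ {i j} → H.Adj i j ⇔ G.Adj (embed i) (embed j)

_-free : ∀ {m n} → FinGraph m → FinGraph n → Set
(H -free) G = ¬ (H InducedSubgraphOf G)

fromEdges : ∀ {n} (E : Rel (Fin n) 0ℓ) → Irreflexive _≡_ E → Decidable E → FinGraph n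
fromEdges E irrefl E? = record
  { graph = record
    { Adj        = SymClosure E
    ; Adj-resp   = resp₂ (SymClosure E)
    ; Adj-sym    = symmetric E
    ; Adj-irrefl = λ { i≡j (fwd e) → irrefl i≡j e ; i≡j (bwd e) → irrefl (sym i≡j) e }
    }
  ; Adj? = adj?
  }
  where
  adj? : Decidable (SymClosure E)
  adj? i j with E? i j | E? j i
  ... | yes e | _      = yes (fwd e)
  ... | no _  | yes e  = yes (bwd e)
  ... | no ¬e | no ¬e′ = no λ { (fwd e) → ¬e e ; (bwd e) → ¬e′ e }

data 2K₂-Edge : Rel (Fin 4) 0ℓ where
  e₀₁ : 2K₂-Edge 0F 1F
  e₂₃ : 2K₂-Edge 2F 3F

data C₄-Edge : Rel (Fin 4) 0ℓ where
  e₀₁ : C₄-Edge 0F 1F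
  e₁₂ : C₄-Edge 1F 2F
  e₂₃ : C₄-Edge 2F 3F
  e₃₀ : C₄-Edge 3F 0F

2K₂ : FinGraph 4
2K₂ = fromEdges 2K₂-Edge (λ { refl () }) edge?
  where
  edge? : Decidable 2K₂-Edge
  edge? 0F 0F = no λ ()
  edge? 0F 1F = yes e₀₁
  edge? 0F 2F = no λ ()
  edge? 0F 3F = no λ ()
  edge? 1F _  = no λ ()
  edge? 2F 0F = no λ ()
  edge? 2F 1F = no λ ()
  edge? 2F 2F = no λ ()
  edge? 2F 3F = yes e₂₃
  edge? 3F _  = no λ ()

C₄ : FinGraph 4
C₄ = fromEdges C₄-Edge (λ { refl () }) edge?
  where
  edge? : Decidable C₄-Edge
  edge? 0F 0F = no λ ()
  edge? 0F 1F = yes e₀₁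
  edge? 0F 2F = no λ ()
  edge? 0F 3F = no λ ()
  edge? 1F 0F = no λ ()
  edge? 1F 1F = no λ ()
  edge? 1F 2F = yes e₁₂
  edge? 1F 3F = no λ ()
  edge? 2F 0F = no λ ()
  edge? 2F 1F = no λ ()
  edge? 2F 2F = no λ ()
  edge? 2F 3F = yes e₂₃
  edge? 3F 0F = yes e₃₀
  edge? 3F 1F = no λ ()
  edge? 3F 2F = no λ ()
  edge? 3F 3F = no λ ()

least : ∀ {P : ℕ → Set} → U.Decidable P → ∀ n → P n →
        ∃[ m ] (P m × (∀ {k} → P k → m ≤ k))
least P? n p with P? 0
... | yes p₀ = 0 , p₀ , λ _ → z≤n
least         P? zero    p | no ¬p₀ = contradiction p ¬p₀
least {P = P} P? (suc n) p | no ¬p₀ with least {P = P ∘ suc} (P? ∘ suc) n p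
... | m , pm , min = suc m , pm , bound
  where
  bound : ∀ {k} → P k → suc m ≤ k
  bound {zero}  p₀ = contradiction p₀ ¬p₀
  bound {suc k} pk = s≤s (min pk)

module _ {n : ℕ} (G : FinGraph n) where
  open FinGraph G

  Proper : ∀ {k} → (Fin n → Fin k) → Set
  Proper α = ∀ u v → Adj u v → α u ≢ α v

  record Colouring (k : ℕ) : Set where
    constructor colouring
    field
      colour : Fin n → Fin k
      proper : Proper colour
  open Colouring

  IsChromaticNumber : ℕ → Set
  IsChromaticNumber c = Colouring c × (∀ {k} → Colouring k → c ≤ k)

  colouring? : ∀ k → Dec (Colouring k)
  colouring? k = map′ to from (any? λ i → proper? (finToFun {k} {n} i))
    where
    proper? : (α : Fin n → Fin k) → Dec (Proper α)
    proper? α = all? λ u → all? λ v → Adj? u v →-dec ¬? (α u ≟ α v)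

    to : (∃ λ (i : Fin (k ^ n)) → Proper (finToFun {k} {n} i)) → Colouring k
    to (i , p) = colouring (finToFun i) p

    from : Colouring k → ∃ λ (i : Fin (k ^ n)) → Proper (finToFun {k} {n} i)
    from (colouring α p) = funToFin α , λ u v uv eq →
      p u v uv (trans (sym (finToFun-funToFin α u)) (trans eq (finToFun-funToFin α v)))

  chromaticNumber : ∃ IsChromaticNumber
  chromaticNumber =
    least colouring? n (colouring id λ u v uv u≡v → Adj-irrefl u≡v uv)

  χ : ℕ
  χ = proj₁ chromaticNumber

  ColouringSetoid : ℕ → Setoid 0ℓ 0ℓ
  ColouringSetoid k = On.setoid (Fin n →-setoid Fin k) (colour {k})

  DifferOnExactlyOneVertex : ∀ {k} → Rel (Colouring k) 0ℓ
  DifferOnExactlyOneVertex α β = ∃! _≡_ λ v → colour α v ≢ colour β v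

  ReconfigurationGraph : ∀ k → Graph (ColouringSetoid k)
  ReconfigurationGraph k = record
    { Adj        = DifferOnExactlyOneVertex
    ; Adj-resp   =
        (λ {α} {β} {β′} β≈β′ (v , α≢β , uniq) →
          v , (λ eq → α≢β (trans eq (sym (β≈β′ v))))
            , λ {u} α≢β′ → uniq (λ eq → α≢β′ (trans eq (β≈β′ u))))
      , (λ {β} {α} {α′} α≈α′ (v , α≢β , uniq) →
          v , (λ eq → α≢β (trans (α≈α′ v) eq))
            , λ {u} α′≢β → uniq (λ eq → α′≢β (trans (sym (α≈α′ u)) eq)))
    ; Adj-sym    = λ (v , α≢β , uniq) → v , (α≢β ∘ sym) , λ β≢α → uniq (β≢α ∘ sym)
    ; Adj-irrefl = λ α≈β (v , α≢β , _) → α≢β (α≈β v)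
    }

{-# OPTIONS --safe #-}
module Submission where

-- Blázsik et al.: a (2K₂, C₄)-free graph is split, or it consists of an induced five-cycle S, a
-- clique K complete to S and an independent set anticomplete to S.  In both cases there is a
-- partition into w ≤ χ(G) independent classes such that every ℓ-colouring becomes constant on the
-- classes, with distinct colours, after at most n recolourings: in the split case every vertex takes
-- the colour of a vertex of a maximal clique that it misses, and in the other case S consists of two
-- non-adjacent pairs, one of which is joined by the independent set, and a single vertex.  Passing
-- between two such colourings is a permutation of w classes with a spare colour, which costs 2n
-- recolourings, so 4n suffice in total.

open import Defs
open import Algebra.Properties.CommutativeSemigroup as CommutativeSemigroup using ()
open import Data.Bool using (if_then_else_)
open import Data.Empty using (⊥; ⊥-elim)
open import Data.Fin using (Fin; zero; suc; finToFun; funToFin; inject≤; punchIn)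
open import Data.Fin.Patterns
open import Data.Fin.Properties using (_≟_; all?; any?; finToFun-funToFin; inject≤-injective; injective⇒≤; punchIn-injective; punchInᵢ≢i; ¬∀⟶∃¬)
open import Data.List using (List; length; lookup; filter; allFin)
open import Data.List.Membership.Propositional using (_∈_)
open import Data.List.Membership.Propositional.Properties using (∈-filter⁺; ∈-filter⁻; ∈-lookup; ∈-allFin)
open import Data.List.Relation.Unary.All as All using ()
open import Data.List.Relation.Unary.AllPairs using () renaming (_∷_ to _∷ᵘ_)
open import Data.List.Relation.Unary.Any using (index)
open import Data.List.Relation.Unary.Any.Properties using (lookup-index)
open import Data.List.Relation.Unary.Unique.Propositional using (Unique)
open import Data.List.Relation.Unary.Unique.Propositional.Properties using (filter⁺; allFin⁺)
open import Data.Nat using (ℕ; zero; suc; _+_; _*_; _≥_; _≤_; _<_; _≤?_; z≤n; s≤s; s≤s⁻¹)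
open import Data.Nat.Properties using (*-distribˡ-+; *-monoʳ-≤; *-monoˡ-≤; +-0-commutativeMonoid; +-assoc; +-cancelʳ-≤; +-comm; +-commutativeSemigroup; +-identityʳ; +-mono-≤; +-monoʳ-<; +-monoʳ-≤; +-monoˡ-<; +-monoˡ-≤; +-suc; <⇒≤; <⇒≱; module ≤-Reasoning; m≤m+n; m≤n+m; n<1+n; ≤-refl; ≤-reflexive; ≤-trans; ≰⇒≥)
open import Algebra.Properties.CommutativeMonoid.Sum +-0-commutativeMonoid using (sum; sum-remove)
open import Data.Product using (_×_; _,_; proj₁; proj₂; ∃; ∃-syntax; Σ-syntax; map₂)
open import Data.Sum as Sum using (_⊎_; inj₁; inj₂)
import Data.Vec.Functional as Vector
open Vector using (_∷_; updateAt; removeAt)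
open import Data.Vec.Functional.Properties using (updateAt-updates; updateAt-minimal)
open import Function using (id; const; _∘_; mk⇔)
open import Function.Definitions using (Injective)
open import Level using (0ℓ)
open import Relation.Binary using (Setoid)
open import Relation.Binary.Construct.Closure.Symmetric using (SymClosure; fwd; bwd)
open import Relation.Binary.PropositionalEquality using (_≡_; _≢_; refl; sym; trans; cong; subst; ≢-sym)
open import Relation.Nullary using (¬_; Dec; yes; no; does; contradiction)
open import Relation.Nullary.Decidable using (map′; ¬?; _×-dec_; _→-dec_; decidable-stable)
import Relation.Unary as U
open import Relation.Unary.Properties using (U?)

open Colouring using (colour; proper)

-- Counting

private variable
  P Q R : Set

indicator : Dec P → ℕ
indicator P? = if does P? then 1 else 0

indicator-≤1 : (P? : Dec P) → indicator P? ≤ 1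
indicator-≤1 (yes _) = ≤-refl
indicator-≤1 (no _)  = z≤n

indicator-mono : (P? : Dec P) (Q? : Dec Q) → (P → Q) → indicator P? ≤ indicator Q?
indicator-mono (no _)  _       _ = z≤n
indicator-mono (yes _) (yes _) _ = ≤-refl
indicator-mono (yes p) (no ¬q) f = contradiction (f p) ¬q

indicator-disjoint : (P? : Dec P) (Q? : Dec Q) (R? : Dec R) → (P → R) → (Q → R) → (P → ¬ Q) →
                     indicator P? + indicator Q? ≤ indicator R?
indicator-disjoint (no _)  Q?      R?      _ g _ = indicator-mono Q? R? g
indicator-disjoint (yes p) (yes q) _       _ _ d = contradiction q (d p)
indicator-disjoint (yes _) (no _)  (yes _) _ _ _ = ≤-refl
indicator-disjoint (yes p) (no _)  (no ¬r) f _ _ = contradiction (f p) ¬r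

count : ∀ {n} {P : Fin n → Set} → U.Decidable P → ℕ
count {zero}  P? = 0
count {suc n} P? = indicator (P? zero) + count (P? ∘ suc)

count-≤n : ∀ {n} {P : Fin n → Set} (P? : U.Decidable P) → count P? ≤ n
count-≤n {zero}  P? = z≤n
count-≤n {suc n} P? = +-mono-≤ (indicator-≤1 (P? zero)) (count-≤n (P? ∘ suc))

count-mono : ∀ {n} {P Q : Fin n → Set} (P? : U.Decidable P) (Q? : U.Decidable Q) →
             (∀ i → P i → Q i) → count P? ≤ count Q?
count-mono {zero}  P? Q? f = z≤n
count-mono {suc n} P? Q? f =
  +-mono-≤ (indicator-mono (P? zero) (Q? zero) (f zero)) (count-mono (P? ∘ suc) (Q? ∘ suc) (f ∘ suc))

-- With a singleton as one of the parts this yields strict decreases; with a class or a set of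
-- recoloured vertices it adds up costs.
count-disjoint : ∀ {n} {P Q R : Fin n → Set}
                 (P? : U.Decidable P) (Q? : U.Decidable Q) (R? : U.Decidable R) →
                 (∀ i → P i → R i) → (∀ i → Q i → R i) → (∀ i → P i → ¬ Q i) →
                 count P? + count Q? ≤ count R?
count-disjoint {zero}  P? Q? R? f g d = z≤n
count-disjoint {suc n} P? Q? R? f g d = begin
  (indicator (P? zero) + count (P? ∘ suc)) + (indicator (Q? zero) + count (Q? ∘ suc))
    ≡⟨ interchange (indicator (P? zero)) (count (P? ∘ suc)) (indicator (Q? zero)) (count (Q? ∘ suc)) ⟩
  (indicator (P? zero) + indicator (Q? zero)) + (count (P? ∘ suc) + count (Q? ∘ suc))
    ≤⟨ +-mono-≤ (indicator-disjoint (P? zero) (Q? zero) (R? zero) (f zero) (g zero) (d zero))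
                (count-disjoint (P? ∘ suc) (Q? ∘ suc) (R? ∘ suc) (f ∘ suc) (g ∘ suc) (d ∘ suc)) ⟩
  indicator (R? zero) + count (R? ∘ suc) ∎
  where
  open ≤-Reasoning
  open CommutativeSemigroup +-commutativeSemigroup using (interchange)

count-≥1 : ∀ {n} {P : Fin n → Set} (P? : U.Decidable P) i → P i → 1 ≤ count P?
count-≥1 P? zero    p with P? zero
... | yes _ = s≤s z≤n
... | no ¬p = contradiction p ¬p
count-≥1 P? (suc i) p = ≤-trans (count-≥1 (P? ∘ suc) i p) (m≤n+m _ (indicator (P? zero)))

largest : ∀ {n} {P : Fin n → Set} → U.Decidable P → (f : Fin n → ℕ) →
          (∀ i → ¬ P i) ⊎ (∃[ i ] (P i × (∀ j → P j → f j ≤ f i)))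
largest {zero}  P? f = inj₁ λ ()
largest {suc n} P? f with P? zero | largest (P? ∘ suc) (f ∘ suc)
... | no ¬p | inj₁ none = inj₁ λ { zero → ¬p ; (suc i) → none i }
... | no ¬p | inj₂ (i , pi , max) =
  inj₂ (suc i , pi , λ { zero p → contradiction p ¬p ; (suc j) → max j })
... | yes p | inj₁ none =
  inj₂ (zero , p , λ { zero _ → ≤-refl ; (suc j) q → contradiction q (none j) })
... | yes p | inj₂ (i , pi , max) with f (suc i) ≤? f zero
...   | yes le = inj₂ (zero , p , λ { zero _ → ≤-refl ; (suc j) q → ≤-trans (max j q) le })
...   | no ¬le = inj₂ (suc i , pi , λ { zero _ → ≰⇒≥ ¬le ; (suc j) → max j })

-- Injective colour assignments and spare colours

fresh : ∀ {k ℓ} → k < ℓ → (t : Fin k → Fin ℓ) → ∃[ c ] (∀ i → t i ≢ c)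
fresh {k} {ℓ} k<ℓ t with any? (λ c → all? λ i → ¬? (t i ≟ c))
... | yes found = found
-- If every colour were taken, picking an index for each would inject `Fin ℓ` into the smaller
-- `Fin k`.
... | no ¬found = contradiction (injective⇒≤ g-injective) (<⇒≱ k<ℓ)
  where
  hit : ∀ c → ∃[ i ] t i ≡ c
  hit c = decidable-stable (any? λ i → t i ≟ c) λ ¬hit → ¬found (c , λ i eq → ¬hit (i , eq))

  g : Fin ℓ → Fin k
  g = proj₁ ∘ hit

  g-injective : Injective _≡_ _≡_ g
  g-injective {c} {d} eq = trans (sym (proj₂ (hit c))) (trans (cong t eq) (proj₂ (hit d)))

∷-injective : ∀ {A : Set} {k} {x : A} {t : Fin k → A} → (∀ i → x ≢ t i) →
              Injective _≡_ _≡_ t → Injective _≡_ _≡_ (x ∷ t)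
∷-injective x∉t inj {zero}  {zero}  _  = refl
∷-injective x∉t inj {zero}  {suc j} eq = contradiction eq (x∉t j)
∷-injective x∉t inj {suc i} {zero}  eq = contradiction (sym eq) (x∉t i)
∷-injective x∉t inj {suc i} {suc j} eq = cong suc (inj eq)

_[_≔_] : ∀ {A : Set} {k} → (Fin k → A) → Fin k → A → (Fin k → A)
a [ i ≔ c ] = updateAt a i (const c)

[≔]-injective : ∀ {A : Set} {k} {a : Fin k → A} {i c} → (∀ j → a j ≢ c) →
                Injective _≡_ _≡_ a → Injective _≡_ _≡_ (a [ i ≔ c ])
[≔]-injective {a = a} {i} {c} c∉a inj {j} {k} eq with j ≟ i | k ≟ i
... | yes refl | yes refl = refl
... | yes refl | no k≢i   = contradiction
  (trans (sym (updateAt-minimal k i a k≢i)) (trans (sym eq) (updateAt-updates i a))) (c∉a k)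
... | no j≢i   | yes refl = contradiction
  (trans (sym (updateAt-minimal j i a j≢i)) (trans eq (updateAt-updates i a))) (c∉a j)
... | no j≢i   | no k≢i   =
  inj (trans (sym (updateAt-minimal j i a j≢i)) (trans eq (updateAt-minimal k i a k≢i)))

-- Walks

module _ {V : Setoid 0ℓ 0ℓ} (G : Graph V) where
  open Setoid V using () renaming (sym to ≈-sym; trans to ≈-trans; refl to ≈-refl)
  open Graph G

  walk-respˡ : ∀ {u u′ v k} → Setoid._≈_ V u u′ → Walk G u v k → Walk G u′ v k
  walk-respˡ u≈u′ (stop u≈v)    = stop (≈-trans (≈-sym u≈u′) u≈v)
  walk-respˡ u≈u′ (step adj w) = step (proj₂ Adj-resp u≈u′ adj) w

  walk-++ : ∀ {u v w j k} → Walk G u v j → Walk G v w k → Walk G u w (j + k)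
  walk-++ (stop u≈v)   q = walk-respˡ (≈-sym u≈v) q
  walk-++ (step adj p) q = step adj (walk-++ p q)

  walk-reverse : ∀ {u v k} → Walk G u v k → Walk G v u k
  walk-reverse (stop u≈v)             = stop (≈-sym u≈v)
  walk-reverse (step {k = k} adj p) =
    subst (Walk G _ _) (+-comm k 1) (walk-++ (walk-reverse p) (step (Adj-sym adj) (stop ≈-refl)))

  -- Recolouring yields only upper bounds on lengths, and a walk cannot in general be padded to a
  -- prescribed length.
  WalkWithin : Setoid.Carrier V → Setoid.Carrier V → ℕ → Set
  WalkWithin u v m = ∃[ k ] (k ≤ m × Walk G u v k)

  within-mono : ∀ {u v k m} → k ≤ m → WalkWithin u v k → WalkWithin u v m
  within-mono k≤m (j , j≤k , p) = j , ≤-trans j≤k k≤m , p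

  within-++ : ∀ {u v w j k} → WalkWithin u v j → WalkWithin v w k → WalkWithin u w (j + k)
  within-++ (_ , le , p) (_ , le′ , q) = _ , +-mono-≤ le le′ , walk-++ p q

  within-reverse : ∀ {u v m} → WalkWithin u v m → WalkWithin v u m
  within-reverse (_ , le , p) = _ , le , walk-reverse p

-- Walks in a reconfiguration graph

module Reconfiguration {n : ℕ} (G : FinGraph n) (ℓ : ℕ) where
  open FinGraph G

  Within : Colouring G ℓ → Colouring G ℓ → ℕ → Set
  Within = WalkWithin (ReconfigurationGraph G ℓ)

  adjacent? : ∀ (α β : Colouring G ℓ) → Dec (DifferOnExactlyOneVertex G α β)
  adjacent? α β = map′ (map₂ (map₂ λ uniq {u} → uniq u)) (map₂ (map₂ λ uniq u → uniq {u}))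
    (any? λ v → ¬? (colour α v ≟ colour β v) ×-dec
      all? λ u → ¬? (colour α u ≟ colour β u) →-dec (v ≟ u))

  proper? : (α : Fin n → Fin ℓ) → Dec (Proper G α)
  proper? α = all? λ u → all? λ v → Adj? u v →-dec ¬? (α u ≟ α v)

  -- Distances are minima, so the existence of walks has to be decided. Intermediate colourings are
  -- functions, which are searched through their codes in `Fin (ℓ ^ n)`.
  walk? : ∀ k (α β : Colouring G ℓ) → Dec (Walk (ReconfigurationGraph G ℓ) α β k)
  walk? zero    α β = map′ stop (λ { (stop eq) → eq }) (all? λ v → colour α v ≟ colour β v)
  walk? (suc k) α β = map′ to from (any? via?)
    where
    Via : (Fin n → Fin ℓ) → Set
    Via γ = Σ[ pr ∈ Proper G γ ] (DifferOnExactlyOneVertex G α (colouring γ pr) ×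
                                  Walk (ReconfigurationGraph G ℓ) (colouring γ pr) β k)

    via? : ∀ i → Dec (Via (finToFun i))
    via? i with proper? (finToFun i)
    ... | no ¬pr = no (¬pr ∘ proj₁)
    -- The given walk may carry another proof of properness; it can be transported because vertices
    -- are compared by their colours only.
    ... | yes pr = map′ (pr ,_) (λ (_ , adj , p) → adj , walk-respˡ _ (λ _ → refl) p)
      (adjacent? α (colouring _ pr) ×-dec walk? k (colouring _ pr) β)

    to : ∃ (Via ∘ finToFun) → Walk (ReconfigurationGraph G ℓ) α β (suc k)
    to (_ , _ , adj , p) = step adj p

    from : Walk (ReconfigurationGraph G ℓ) α β (suc k) → ∃ (Via ∘ finToFun)
    from (step {w = γ} adj p) = funToFin (colour γ) , proper γ′ ,
      proj₁ (Graph.Adj-resp (ReconfigurationGraph G ℓ)) {α} {γ} {γ′} γ≈γ′ adj , walk-respˡ _ γ≈γ′ p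
      where
      γ≈γ′ : ∀ v → colour γ v ≡ finToFun (funToFin (colour γ)) v
      γ≈γ′ v = sym (finToFun-funToFin (colour γ) v)

      γ′ : Colouring G ℓ
      γ′ = colouring (finToFun (funToFin (colour γ))) λ u v uv eq →
        proper γ u v uv (trans (γ≈γ′ u) (trans eq (sym (γ≈γ′ v))))

  diameterAtMost : ∀ {m} → (∀ α β → Within α β m) → DiameterAtMost (ReconfigurationGraph G ℓ) m
  diameterAtMost within α β =
    let k , k≤m , p = within α β
        d , q , min = least (λ j → walk? j α β) k p
    in d , (q , min) , ≤-trans (min p) k≤m

  differences : ∀ {m} → (Fin m → Fin ℓ) → (Fin m → Fin ℓ) → ℕ
  differences α β = count λ v → ¬? (α v ≟ β v)

  IndependentChange : (α β : Colouring G ℓ) → Set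
  IndependentChange α β = ∀ u v → Adj u v → colour α u ≡ colour β u ⊎ colour α v ≡ colour β v

  -- The differing vertices can be corrected one by one in any order: the neighbours of such a
  -- vertex already have their colours of `β`, none of which is the new colour of the vertex.
  recolour-independent : ∀ α β → IndependentChange α β →
                         Within α β (differences (colour α) (colour β))
  recolour-independent α β indep = go _ α indep ≤-refl
    where
    go : ∀ k α → IndependentChange α β → differences (colour α) (colour β) ≤ k → Within α β k
    go k α indep d≤k with any? (λ v → ¬? (colour α v ≟ colour β v))
    ... | no same = 0 , z≤n , stop λ v →
      decidable-stable (colour α v ≟ colour β v) λ α≢β → same (v , α≢β)
    go zero α indep d≤0 | yes (v , α≢β) =
      contradiction (≤-trans (count-≥1 (λ v → ¬? (colour α v ≟ colour β v)) v α≢β) d≤0) λ ()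
    go (suc k) α indep d≤1+k | yes (v , α≢β) =
      let j , j≤k , p = go k α′ indep′ (+-cancelʳ-≤ 1 _ _ fewer)
      in suc j , s≤s j≤k , step α~α′ p
      where
      c′ : Fin n → Fin ℓ
      c′ = colour α [ v ≔ colour β v ]

      at-v : c′ v ≡ colour β v
      at-v = updateAt-updates v (colour α)

      off-v : ∀ {u} → u ≢ v → c′ u ≡ colour α u
      off-v {u} = updateAt-minimal u v (colour α)

      neighbour : ∀ {u} → Adj v u → colour β v ≢ colour α u
      neighbour {u} vu eq with indep v u vu
      ... | inj₁ same = α≢β same
      ... | inj₂ same = proper β v u vu (trans eq same)

      proper′ : Proper G c′
      proper′ u w uw eq with u ≟ v | w ≟ v
      ... | yes refl | yes refl = Adj-irrefl refl uw
      ... | yes refl | no w≢v   = neighbour uw (trans (sym at-v) (trans eq (off-v w≢v)))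
      ... | no u≢v   | yes refl = neighbour (Adj-sym uw) (trans (sym at-v) (trans (sym eq) (off-v u≢v)))
      ... | no u≢v   | no w≢v   = proper α u w uw (trans (sym (off-v u≢v)) (trans eq (off-v w≢v)))

      α′ : Colouring G ℓ
      α′ = colouring c′ proper′

      keeps : ∀ u → colour α u ≡ colour β u → c′ u ≡ colour β u
      keeps u same with u ≟ v
      ... | yes refl = at-v
      ... | no u≢v   = trans (off-v u≢v) same

      indep′ : IndependentChange α′ β
      indep′ u w uw with indep u w uw
      ... | inj₁ same = inj₁ (keeps u same)
      ... | inj₂ same = inj₂ (keeps w same)

      α~α′ : DifferOnExactlyOneVertex G α α′
      α~α′ = v , (λ eq → α≢β (trans eq at-v)) , λ {u} α≢α′ →
        sym (decidable-stable (u ≟ v) λ u≢v → α≢α′ (sym (off-v u≢v)))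

      fewer : differences c′ (colour β) + 1 ≤ k + 1
      fewer = begin
        differences c′ (colour β) + 1
          ≤⟨ +-monoʳ-≤ (differences c′ (colour β)) (count-≥1 (_≟ v) v refl) ⟩
        differences c′ (colour β) + count (_≟ v)
          ≤⟨ count-disjoint (λ u → ¬? (c′ u ≟ colour β u)) (_≟ v) (λ u → ¬? (colour α u ≟ colour β u))
               (λ u ne same → ne (keeps u same)) (λ { _ refl → α≢β }) (λ { _ ne refl → ne at-v }) ⟩
        differences (colour α) (colour β)
          ≤⟨ d≤1+k ⟩
        suc k
          ≡⟨ +-comm 1 k ⟩
        k + 1 ∎
        where open ≤-Reasoning

  -- Colourings that are constant on independent classes

  module Classes {w : ℕ} (p : Fin n → Fin w) (separates : ∀ {u v} → Adj u v → p u ≢ p v) where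

    paint : (a : Fin w → Fin ℓ) → Injective _≡_ _≡_ a → Colouring G ℓ
    paint a inj = colouring (a ∘ p) λ u v uv eq → separates uv (inj eq)

    classSize : Fin w → ℕ
    classSize i = count λ v → p v ≟ i

    -- Only class `i` changes, and by `separates` no edge has both ends in it.
    move-class : ∀ {a} (inj : Injective _≡_ _≡_ a) i {c} (c∉a : ∀ j → a j ≢ c) →
                 Within (paint a inj) (paint (a [ i ≔ c ]) ([≔]-injective c∉a inj)) (classSize i)
    move-class {a} inj i {c} c∉a = within-mono _ size (recolour-independent _ _ indep)
      where
      unmoved : ∀ {j} → j ≢ i → a j ≡ (a [ i ≔ c ]) j
      unmoved {j} j≢i = sym (updateAt-minimal j i a j≢i)

      indep : IndependentChange (paint a inj) (paint (a [ i ≔ c ]) ([≔]-injective c∉a inj))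
      indep u v uv with p u ≟ i
      ... | yes pu≡i = inj₂ (unmoved λ pv≡i → separates uv (trans pu≡i (sym pv≡i)))
      ... | no pu≢i  = inj₁ (unmoved pu≢i)

      size : differences (a ∘ p) ((a [ i ≔ c ]) ∘ p) ≤ classSize i
      size = count-mono (λ v → ¬? (a (p v) ≟ (a [ i ≔ c ]) (p v))) (λ v → p v ≟ i) λ v ne →
        decidable-stable (p v ≟ i) (ne ∘ unmoved)

    -- Only a largest class among those that still have a wrong colour is given its final colour.
    -- The class that it may displace is no larger, so that the two moves together cost at most
    -- twice the number of vertices that become right.
    rename : w < ℓ → ∀ {a b} (a-inj : Injective _≡_ _≡_ a) (b-inj : Injective _≡_ _≡_ b) →
             Within (paint a a-inj) (paint b b-inj) (2 * differences (a ∘ p) (b ∘ p))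
    rename w<ℓ {a} {b} a-inj b-inj = go _ a-inj ≤-refl
      where
      -- The fuel `k` bounds the number of wrongly coloured classes, whereas the cost counts
      -- vertices.
      go : ∀ k {a} (a-inj : Injective _≡_ _≡_ a) → differences a b ≤ k →
           Within (paint a a-inj) (paint b b-inj) (2 * differences (a ∘ p) (b ∘ p))
      go k {a} a-inj d≤k with largest (λ i → ¬? (a i ≟ b i)) classSize
      ... | inj₁ none = 0 , z≤n , stop λ v → decidable-stable (a (p v) ≟ b (p v)) (none (p v))
      ... | inj₂ (i , ai≢bi , max) = settle k d≤k
        where
        module Settled {a′} (a′-inj : Injective _≡_ _≡_ a′)
                       (a⇝a′ : Within (paint a a-inj) (paint a′ a′-inj) (2 * classSize i))
                       (at-i : a′ i ≡ b i) (keeps : ∀ j → a j ≡ b j → a′ j ≡ b j) where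

          -- Used with `id`, where it counts classes and gives termination, and with `p`, where it
          -- counts vertices and gives the cost.
          fewer : ∀ {m} (q : Fin m → Fin w) →
                  count (λ v → q v ≟ i) + differences (a′ ∘ q) (b ∘ q) ≤ differences (a ∘ q) (b ∘ q)
          fewer q = count-disjoint (λ v → q v ≟ i) (λ v → ¬? (a′ (q v) ≟ b (q v)))
            (λ v → ¬? (a (q v) ≟ b (q v)))
            (λ { _ refl → ai≢bi }) (λ v ne → ne ∘ keeps (q v)) (λ { _ refl ne → ne at-i })

          continue : ∀ k → differences a b ≤ k →
                     Within (paint a a-inj) (paint b b-inj) (2 * differences (a ∘ p) (b ∘ p))
          continue zero d≤0 = contradiction
            (≤-trans (count-≥1 (λ j → ¬? (a j ≟ b j)) i ai≢bi) d≤0) λ ()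
          continue (suc k) d≤1+k = within-mono _ cost (within-++ _ a⇝a′ (go k a′-inj d′≤k))
            where
            open ≤-Reasoning

            d′≤k : differences a′ b ≤ k
            d′≤k = s≤s⁻¹ (begin
              1 + differences a′ b              ≤⟨ +-monoˡ-≤ _ (count-≥1 (_≟ i) i refl) ⟩
              count (_≟ i) + differences a′ b   ≤⟨ fewer id ⟩
              differences a b                   ≤⟨ d≤1+k ⟩
              suc k                             ∎)

            cost : 2 * classSize i + 2 * differences (a′ ∘ p) (b ∘ p) ≤ 2 * differences (a ∘ p) (b ∘ p)
            cost = begin
              2 * classSize i + 2 * differences (a′ ∘ p) (b ∘ p)
                ≡⟨ *-distribˡ-+ 2 (classSize i) _ ⟨
              2 * (classSize i + differences (a′ ∘ p) (b ∘ p))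
                ≤⟨ *-monoʳ-≤ 2 (fewer p) ⟩
              2 * differences (a ∘ p) (b ∘ p) ∎

        settle : ∀ k → differences a b ≤ k →
                 Within (paint a a-inj) (paint b b-inj) (2 * differences (a ∘ p) (b ∘ p))
        settle with any? (λ j → a j ≟ b i)
        ... | no free = Settled.continue ([≔]-injective bi∉a a-inj)
          (within-mono _ (m≤m+n (classSize i) _) (move-class a-inj i bi∉a))
          (updateAt-updates i a) keeps
          where
          bi∉a : ∀ j → a j ≢ b i
          bi∉a j eq = free (j , eq)

          keeps : ∀ j → a j ≡ b j → (a [ i ≔ b i ]) j ≡ b j
          keeps j eq with j ≟ i
          ... | yes refl = contradiction eq ai≢bi
          ... | no j≢i   = trans (updateAt-minimal j i a j≢i) eq
        -- The colour `b i` is held by class `j`, which first gives way to a spare colour. Since `b`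
        -- is injective, `j` is wrong too; so no right class is disturbed, and by the choice of `i`
        -- the class `j` is no larger.
        ... | yes (j , aj≡bi) = Settled.continue ([≔]-injective bi∉a′ a′-inj)
          (within-mono _ cost (within-++ _ (move-class a-inj j c∉a) (move-class a′-inj i bi∉a′)))
          (updateAt-updates i a′) keeps
          where
          open ≤-Reasoning

          i≢j : i ≢ j
          i≢j refl = ai≢bi aj≡bi

          aj≢bj : a j ≢ b j
          aj≢bj eq = i≢j (b-inj (trans (sym aj≡bi) eq))

          c : Fin ℓ
          c = proj₁ (fresh w<ℓ a)

          c∉a : ∀ k → a k ≢ c
          c∉a = proj₂ (fresh w<ℓ a)

          a′ : Fin w → Fin ℓ
          a′ = a [ j ≔ c ]

          a′-inj : Injective _≡_ _≡_ a′
          a′-inj = [≔]-injective c∉a a-inj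

          bi∉a′ : ∀ k → a′ k ≢ b i
          bi∉a′ k eq with k ≟ j
          ... | yes refl = c∉a j (trans aj≡bi (trans (sym eq) (updateAt-updates j a)))
          ... | no k≢j   = k≢j (a-inj
            (trans (sym (updateAt-minimal k j a k≢j)) (trans eq (sym aj≡bi))))

          keeps : ∀ k → a k ≡ b k → (a′ [ i ≔ b i ]) k ≡ b k
          keeps k eq with k ≟ i | k ≟ j
          ... | yes refl | _        = contradiction eq ai≢bi
          ... | no _     | yes refl = contradiction eq aj≢bj
          ... | no k≢i   | no k≢j   =
            trans (updateAt-minimal k i a′ k≢i) (trans (updateAt-minimal k j a k≢j) eq)

          cost : classSize j + classSize i ≤ 2 * classSize i
          cost = begin
            classSize j + classSize i         ≤⟨ +-monoˡ-≤ _ (max j aj≢bj) ⟩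
            classSize i + classSize i         ≡⟨ cong (classSize i +_) (+-identityʳ _) ⟨
            2 * classSize i                   ∎

  -- What each structural case has to supply. The classes are chosen before `α`, so two normalised
  -- colourings differ only in the colours given to the same classes and `rename` leads from one to
  -- the other.
  record NormalForm : Set where
    field
      {w}       : ℕ
      w<ℓ       : w < ℓ
      class     : Fin n → Fin w
      separates : ∀ {u v} → Adj u v → class u ≢ class v
    open Classes class separates public
    field
      normalise : ∀ α → ∃[ a ] Σ[ inj ∈ Injective _≡_ _≡_ a ] Within α (paint a inj) n

  within-4n : NormalForm → ∀ α β → Within α β (4 * n)
  within-4n N α β =
    let a , a-inj , α⇝a = normalise α
        b , b-inj , β⇝b = normalise β
    -- The three pieces add up to `n + (2 * n + n)`, whereas `4 * n` unfolds to `n + (n + 2 * n)`.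
    in within-mono _ (≤-reflexive (cong (n +_) (+-comm (2 * n) n)))
         (within-++ _ α⇝a (within-++ _
           (within-mono _ (*-monoʳ-≤ 2 (count-≤n λ v → ¬? (a (class v) ≟ b (class v)))) (rename w<ℓ a-inj b-inj))
           (within-reverse _ β⇝b)))
    where open NormalForm N

-- The structure of (2K₂, C₄)-free graphs

module _ {n : ℕ} (G : FinGraph n) where
  open FinGraph G

  Clique : ∀ {w} → (Fin w → Fin n) → Set
  Clique e = ∀ {i j} → i ≢ j → Adj (e i) (e j)

  clique-∷ : ∀ {w x} {e : Fin w → Fin n} → (∀ i → Adj x (e i)) → Clique e → Clique (x ∷ e)
  clique-∷ x~e clq {zero}  {zero}  i≢j = contradiction refl i≢j
  clique-∷ x~e clq {zero}  {suc j} _   = x~e j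
  clique-∷ x~e clq {suc i} {zero}  _   = Adj-sym (x~e i)
  clique-∷ x~e clq {suc i} {suc j} i≢j = clq (i≢j ∘ cong suc)

  clique-removeAt : ∀ {w} {e : Fin (suc w) → Fin n} i → Clique e → Clique (removeAt e i)
  clique-removeAt i clq j≢k = clq (j≢k ∘ punchIn-injective i _ _)

  clique-colours : ∀ {w k} {e : Fin w → Fin n} → Clique e → (γ : Colouring G k) →
                   Injective _≡_ _≡_ (colour γ ∘ e)
  clique-colours clq γ {i} {j} eq =
    decidable-stable (i ≟ j) λ i≢j → proper γ _ _ (clq i≢j) eq

  -- Within the clique, a clique vertex misses only itself. So `v ≡ clique (missed v)` says that `v`
  -- lies in the clique, and `cover` that the vertices outside are independent. The function
  -- `missed` witnesses that the clique is maximal.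
  record Split : Set where
    field
      {w}          : ℕ
      clique       : Fin w → Fin n
      isClique     : Clique clique
      missed       : Fin n → Fin w
      misses       : ∀ v → ¬ Adj v (clique (missed v))
      cover        : ∀ {u v} → Adj u v → u ≡ clique (missed u) ⊎ v ≡ clique (missed v)

  -- Edges and non-edges are both oriented around the cycle, so that `rotate` only shifts the
  -- fields.
  record FiveCycle (a b c d e : Fin n) : Set where
    constructor fiveCycle
    field
      ab : Adj a b
      bc : Adj b c
      cd : Adj c d
      de : Adj d e
      ea : Adj e a
      ac : ¬ Adj a c
      bd : ¬ Adj b d
      ce : ¬ Adj c e
      da : ¬ Adj d a
      eb : ¬ Adj e b

    a≢c : a ≢ c
    a≢c refl = da (Adj-sym cd)

  rotate : ∀ {a b c d e} → FiveCycle a b c d e → FiveCycle b c d e a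
  rotate (fiveCycle ab bc cd de ea ac bd ce da eb) = fiveCycle bc cd de ea ab bd ce da eb ac

module Structure {n : ℕ} (G : FinGraph n) (2K₂-free : (2K₂ -free) G) (C₄-free : (C₄ -free) G) where
  open FinGraph G

  Adj-≢ : ∀ {u v} → Adj u v → u ≢ v
  Adj-≢ uv refl = Adj-irrefl refl uv

  quadruple-injective : ∀ {a b c d : Fin n} → a ≢ b → a ≢ c → a ≢ d → b ≢ c → b ≢ d → c ≢ d →
                        Injective _≡_ _≡_ (a ∷ b ∷ c ∷ d ∷ Vector.[])
  quadruple-injective ab ac ad bc bd cd =
    ∷-injective {k = 3} (λ { 0F → ab ; 1F → ac ; 2F → ad })
      (∷-injective {k = 2} (λ { 0F → bc ; 1F → bd })
        (∷-injective {k = 1} (λ { 0F → cd }) (∷-injective (λ ()) λ { {()} })))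

  -- Distinctness comes for free: identifying ends of the two edges would turn one of these edges
  -- into an excluded adjacency.
  no-2K₂ : ∀ {a b c d} → Adj a b → Adj c d →
           ¬ Adj a c → ¬ Adj a d → ¬ Adj b c → ¬ Adj b d → ⊥
  no-2K₂ {a} {b} {c} {d} ab cd ac ad bc bd = 2K₂-free record
    { embed           = emb
    ; embed-injective = quadruple-injective (Adj-≢ ab) (λ { refl → ad cd }) (λ { refl → ac (Adj-sym cd) })
                          (λ { refl → bd cd }) (λ { refl → bc (Adj-sym cd) }) (Adj-≢ cd)
    ; embed-adj       = λ {i} {j} → mk⇔ to (from i j)
    }
    where
    emb : Fin 4 → Fin n
    emb = a ∷ b ∷ c ∷ d ∷ Vector.[]

    to : ∀ {i j} → SymClosure 2K₂-Edge i j → Adj (emb i) (emb j)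
    to (fwd e₀₁) = ab
    to (fwd e₂₃) = cd
    to (bwd e₀₁) = Adj-sym ab
    to (bwd e₂₃) = Adj-sym cd

    from : ∀ i j → Adj (emb i) (emb j) → SymClosure 2K₂-Edge i j
    from 0F 0F h = contradiction h (Adj-irrefl refl)
    from 0F 1F h = fwd e₀₁
    from 0F 2F h = contradiction h ac
    from 0F 3F h = contradiction h ad
    from 1F 0F h = bwd e₀₁
    from 1F 1F h = contradiction h (Adj-irrefl refl)
    from 1F 2F h = contradiction h bc
    from 1F 3F h = contradiction h bd
    from 2F 0F h = contradiction (Adj-sym h) ac
    from 2F 1F h = contradiction (Adj-sym h) bc
    from 2F 2F h = contradiction h (Adj-irrefl refl)
    from 2F 3F h = fwd e₂₃
    from 3F 0F h = contradiction (Adj-sym h) ad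
    from 3F 1F h = contradiction (Adj-sym h) bd
    from 3F 2F h = bwd e₂₃
    from 3F 3F h = contradiction h (Adj-irrefl refl)

  no-C₄ : ∀ {a b c d} → Adj a b → Adj b c → Adj c d → Adj d a →
          ¬ Adj a c → ¬ Adj b d → a ≢ c → b ≢ d → ⊥
  no-C₄ {a} {b} {c} {d} ab bc cd da ac bd a≢c b≢d = C₄-free record
    { embed           = emb
    ; embed-injective = quadruple-injective (Adj-≢ ab) a≢c (≢-sym (Adj-≢ da)) (Adj-≢ bc) b≢d (Adj-≢ cd)
    ; embed-adj       = λ {i} {j} → mk⇔ to (from i j)
    }
    where
    emb : Fin 4 → Fin n
    emb = a ∷ b ∷ c ∷ d ∷ Vector.[]

    to : ∀ {i j} → SymClosure C₄-Edge i j → Adj (emb i) (emb j)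
    to (fwd e₀₁) = ab
    to (fwd e₁₂) = bc
    to (fwd e₂₃) = cd
    to (fwd e₃₀) = da
    to (bwd e₀₁) = Adj-sym ab
    to (bwd e₁₂) = Adj-sym bc
    to (bwd e₂₃) = Adj-sym cd
    to (bwd e₃₀) = Adj-sym da

    from : ∀ i j → Adj (emb i) (emb j) → SymClosure C₄-Edge i j
    from 0F 0F h = contradiction h (Adj-irrefl refl)
    from 0F 1F h = fwd e₀₁
    from 0F 2F h = contradiction h ac
    from 0F 3F h = bwd e₃₀
    from 1F 0F h = bwd e₀₁
    from 1F 1F h = contradiction h (Adj-irrefl refl)
    from 1F 2F h = fwd e₁₂
    from 1F 3F h = contradiction h bd
    from 2F 0F h = contradiction (Adj-sym h) ac
    from 2F 1F h = bwd e₁₂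
    from 2F 2F h = contradiction h (Adj-irrefl refl)
    from 2F 3F h = fwd e₂₃
    from 3F 0F h = fwd e₃₀
    from 3F 1F h = contradiction (Adj-sym h) bd
    from 3F 2F h = bwd e₂₃
    from 3F 3F h = contradiction h (Adj-irrefl refl)

  -- Growing a clique by weight

  degree : Fin n → ℕ
  degree v = count (Adj? v)

  -- Heavier cliques are larger or, at equal size, leave fewer edges outside them.
  vertexWeight : Fin n → ℕ
  vertexWeight v = suc n + degree v

  weight : ∀ {w} → (Fin w → Fin n) → ℕ
  weight e = sum (vertexWeight ∘ e)

  vertexWeight-≤ : ∀ v → vertexWeight v ≤ suc n + n
  vertexWeight-≤ v = +-monoʳ-≤ (suc n) (count-≤n (Adj? v))

  weight-≤ : ∀ {w} (e : Fin w → Fin n) → weight e ≤ w * (suc n + n)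
  weight-≤ {zero}  e = z≤n
  weight-≤ {suc w} e = +-mono-≤ (vertexWeight-≤ (e zero)) (weight-≤ (e ∘ suc))

  clique-size : ∀ {w} {e : Fin w → Fin n} → Clique G e → w ≤ n
  clique-size clq = injective⇒≤ (clique-colours G clq (colouring id λ u v uv u≡v → Adj-irrefl u≡v uv))

  HasFiveCycle : Set
  HasFiveCycle = ∃[ a ] ∃[ b ] ∃[ c ] ∃[ d ] ∃[ e ] FiveCycle G a b c d e

  HeavierClique : ℕ → Set
  HeavierClique m = ∃[ w ] Σ[ e ∈ (Fin w → Fin n) ] (Clique G e × m < weight e)

  -- Replacing e z by x, or by both x and y, yields a heavier clique, unless y and a neighbour of e z
  -- that x misses lie on an induced five-cycle.
  exchange : ∀ {w} {e : Fin w → Fin n} → Clique G e → ∀ {x y} z →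
             Adj x y → (∀ i → x ≢ e i) → (∀ i → y ≢ e i) → ¬ Adj x (e z) →
             (∀ i → ¬ Adj x (e i) → ¬ Adj y (e i)) →
             HasFiveCycle ⊎ HeavierClique (weight e)
  exchange {suc w} {e} clq {x} {y} z xy x∉e y∉e xz x⊆y =
    exchange′ (any? λ i → ¬? (i ≟ z) ×-dec ¬? (Adj? y (e i)))
    where
    open ≤-Reasoning

    -- Otherwise the edge from `x` to `y` and the edge from `e i` to `e z` would induce a `2K₂`, as
    -- `y` misses whatever `x` misses in the clique.
    x~rest : ∀ {i} → i ≢ z → Adj x (e i)
    x~rest {i} i≢z = decidable-stable (Adj? x (e i)) λ xi →
      no-2K₂ xy (clq i≢z) xi xz (x⊆y i xi) (x⊆y z xz)

    swapped : Fin (suc w) → Fin n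
    swapped = x ∷ removeAt e z

    swapped-clique : Clique G swapped
    swapped-clique = clique-∷ G (λ i → x~rest (punchInᵢ≢i z i)) (clique-removeAt G z clq)

    weight-e : weight e ≡ vertexWeight (e z) + weight (removeAt e z)
    weight-e = sum-remove {i = z} (vertexWeight ∘ e)

    exchange′ : Dec (∃[ i ] (i ≢ z × ¬ Adj y (e i))) → HasFiveCycle ⊎ HeavierClique (weight e)
    exchange′ (no y~rest) = inj₂ (_ , y ∷ swapped , clique-∷ G y~swapped swapped-clique , heavier)
      where
      y~swapped : ∀ i → Adj y (swapped i)
      y~swapped zero    = Adj-sym xy
      y~swapped (suc i) = decidable-stable (Adj? y (e (punchIn z i))) λ yi →
        y~rest (punchIn z i , punchInᵢ≢i z i , yi)

      -- The two new vertices together weigh at least `2n + 2`, the lost vertex `e z` at most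
      -- `2n + 1`.
      heavier : weight e < weight (y ∷ swapped)
      heavier = begin-strict
        weight e                                       ≡⟨ weight-e ⟩
        vertexWeight (e z) + weight (removeAt e z)     ≤⟨ +-monoˡ-≤ _ (vertexWeight-≤ (e z)) ⟩
        (suc n + n) + weight (removeAt e z)            <⟨ +-monoˡ-< _ (+-monoʳ-< (suc n) ≤-refl) ⟩
        (suc n + suc n) + weight (removeAt e z)       
          ≤⟨ +-monoˡ-≤ (weight (removeAt e z))
               (+-mono-≤ (m≤m+n (suc n) (degree y)) (m≤m+n (suc n) (degree x))) ⟩
        (vertexWeight y + vertexWeight x) + weight (removeAt e z)
          ≡⟨ +-assoc (vertexWeight y) _ _ ⟩
        weight (y ∷ swapped) ∎
    exchange′ (yes (b , b≢z , yb)) with any? (λ v → Adj? (e z) v ×-dec ¬? (Adj? x v))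
    ... | no z⊆x = inj₂ (_ , swapped , swapped-clique , heavier)
      where
      degree-< : degree (e z) < degree x
      degree-< = begin-strict
        degree (e z)                    <⟨ n<1+n _ ⟩
        1 + degree (e z)                ≤⟨ +-monoˡ-≤ _ (count-≥1 (_≟ y) y refl) ⟩
        count (_≟ y) + degree (e z)
          ≤⟨ count-disjoint (_≟ y) (Adj? (e z)) (Adj? x) (λ { _ refl → xy })
               (λ v zv → decidable-stable (Adj? x v) λ xv → z⊆x (v , zv , xv))
               (λ { _ refl zy → x⊆y z xz (Adj-sym zy) }) ⟩
        degree x ∎

      heavier : weight e < weight swapped
      heavier = begin-strict
        weight e                                   ≡⟨ weight-e ⟩
        vertexWeight (e z) + weight (removeAt e z) <⟨ +-monoˡ-< _ (+-monoʳ-< (suc n) degree-<) ⟩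
        weight swapped                             ∎
    -- If `y` missed `v`, the edges from `x` to `y` and from `e z` to `v` would induce a `2K₂`; a
    -- chord from `v` to `e b` would close an induced `C₄` with `x` and `y`.
    ... | yes (v , zv , xv) = inj₁ (x , y , v , e z , e b ,
      fiveCycle xy yv (Adj-sym zv) (clq (≢-sym b≢z)) (Adj-sym (x~rest b≢z))
        xv (x⊆y z xz) vb (xz ∘ Adj-sym) (yb ∘ Adj-sym))
      where
      yv : Adj y v
      yv = decidable-stable (Adj? y v) λ yv → no-2K₂ xy zv xz xv (x⊆y z xz) yv

      vb : ¬ Adj v (e b)
      vb vb = no-C₄ xy yv vb (Adj-sym (x~rest b≢z)) xv yb (λ { refl → xz (Adj-sym zv) }) (y∉e b)

  -- A vertex complete to the clique is added to it. If there is none and the vertices outside are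
  -- not independent, the ends of an edge outside have nested sets of missed clique vertices, as
  -- `exchange` requires.
  improve : ∀ {w} {e : Fin w → Fin n} → Clique G e →
            Split G ⊎ HasFiveCycle ⊎ HeavierClique (weight e)
  improve {w} {e} clq with any? (λ x → all? λ i → Adj? x (e i))
  ... | yes (x , x~e) = inj₂ (inj₂ (_ , x ∷ e , clique-∷ G x~e clq , s≤s (m≤n+m _ (n + degree x))))
  ... | no undominated = improve′
    (any? λ x → any? λ y → Adj? x y ×-dec ¬? (x ≟ e (missed x)) ×-dec ¬? (y ≟ e (missed y)))
    where
    missing : ∀ x → ∃[ i ] ¬ Adj x (e i)
    missing x = ¬∀⟶∃¬ w _ (λ i → Adj? x (e i)) λ x~e → undominated (x , x~e)

    missed : Fin n → Fin w
    missed = proj₁ ∘ missing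

    -- A clique vertex misses nothing in the clique but itself, so this one inequality excludes all
    -- of it.
    outside : ∀ {x} → x ≢ e (missed x) → ∀ i → x ≢ e i
    outside {x} x≢ i refl with i ≟ missed x
    ... | yes i≡ = x≢ (cong e i≡)
    ... | no i≢  = proj₂ (missing x) (clq i≢)

    improve′ : Dec (∃[ x ] ∃[ y ] (Adj x y × x ≢ e (missed x) × y ≢ e (missed y))) →
               Split G ⊎ HasFiveCycle ⊎ HeavierClique (weight e)
    improve′ (no covered) = inj₁ record
      { clique = e ; isClique = clq ; missed = missed ; misses = proj₂ ∘ missing ; cover = cover }
      where
      cover : ∀ {u v} → Adj u v → u ≡ e (missed u) ⊎ v ≡ e (missed v)
      cover {u} {v} uv with u ≟ e (missed u)
      ... | yes eq = inj₁ eq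
      ... | no u≢  = inj₂ (decidable-stable (v ≟ e (missed v)) λ v≢ → covered (u , v , uv , u≢ , v≢))
    improve′ (yes (x , y , xy , x≢ , y≢)) = inj₂ (compare
      (any? λ i → ¬? (Adj? x (e i)) ×-dec Adj? y (e i))
      (any? λ j → ¬? (Adj? y (e j)) ×-dec Adj? x (e j)))
      where
      compare : Dec (∃[ i ] (¬ Adj x (e i) × Adj y (e i))) → Dec (∃[ j ] (¬ Adj y (e j) × Adj x (e j))) →
                HasFiveCycle ⊎ HeavierClique (weight e)
      compare (no x⊆y) _ = exchange clq (missed x) xy (outside x≢) (outside y≢) (proj₂ (missing x))
        λ i xi yi → x⊆y (i , xi , yi)
      compare _ (no y⊆x) = exchange clq (missed y) (Adj-sym xy) (outside y≢) (outside x≢) (proj₂ (missing y))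
        λ i yi xi → y⊆x (i , yi , xi)
      -- Were the missed sets not nested, `x`, `y`, `e i`, `e j` would induce a `C₄`.
      compare (yes (i , xi , yi)) (yes (j , yj , xj)) = ⊥-elim
        (no-C₄ xy yi (clq λ { refl → yj yi }) (Adj-sym xj) xi yj (outside x≢ i) (outside y≢ j))

  -- Starting from the empty clique, each heavier clique uses up one unit of `k`. A clique has at
  -- most `n` vertices, each of weight at most `2n + 1`, so the search ends in one of the other two
  -- outcomes of `improve`.
  split-or-fiveCycle : Split G ⊎ HasFiveCycle
  split-or-fiveCycle = search (n * (suc n + n)) {e = Vector.[]} (λ { {()} }) (m≤m+n _ 0)
    where
    search : ∀ k {w} {e : Fin w → Fin n} → Clique G e → n * (suc n + n) ≤ k + weight e →
             Split G ⊎ HasFiveCycle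
    search k {e = e} clq bound with improve clq
    ... | inj₁ split = inj₁ split
    ... | inj₂ (inj₁ cycle) = inj₂ cycle
    search zero {e = e} clq bound | inj₂ (inj₂ (w′ , e′ , clq′ , heavier)) = contradiction
      (≤-trans (weight-≤ e′) (*-monoˡ-≤ (suc n + n) (clique-size clq′))) (<⇒≱ (≤-trans (s≤s bound) heavier))
    search (suc k) {e = e} clq bound | inj₂ (inj₂ (w′ , e′ , clq′ , heavier)) =
      search k clq′ (≤-trans bound (≤-trans (≤-reflexive (sym (+-suc k _))) (+-monoʳ-≤ k heavier)))

  -- By `2K₂`-freeness a neighbour of `v` on the cycle forces `v` to see an end of the opposite
  -- edge; by `C₄`-freeness, seeing both ends of a path on three cycle vertices forces seeing its
  -- middle (`between`).
  sees-all : ∀ {a b c d e v} → FiveCycle G a b c d e → v ≢ b → v ≢ c → v ≢ d → v ≢ e → Adj v a →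
             Adj v b × Adj v c × Adj v d × Adj v e
  sees-all {a} {b} {c} {d} {e} {v} C v≢b v≢c v≢d v≢e va = go (Adj? v b) (Adj? v c) (Adj? v d) (Adj? v e)
    where
    open FiveCycle C

    between : ∀ {x y z} → Adj x y → Adj y z → ¬ Adj x z → x ≢ z → v ≢ y → Adj v x → Adj v z → ¬ ¬ Adj v y
    between xy yz xz x≢z v≢y vx vz vy = no-C₄ vx xy yz (Adj-sym vz) vy xz v≢y x≢z

    c≢e : c ≢ e
    c≢e = FiveCycle.a≢c (rotate G (rotate G C))

    b≢d : b ≢ d
    b≢d = FiveCycle.a≢c (rotate G C)

    d≢a : d ≢ a
    d≢a = FiveCycle.a≢c (rotate G (rotate G (rotate G C)))

    go : Dec (Adj v b) → Dec (Adj v c) → Dec (Adj v d) → Dec (Adj v e) →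
         Adj v b × Adj v c × Adj v d × Adj v e
    go (yes vb) (yes vc) (yes vd) (yes ve) = vb , vc , vd , ve
    go (no vb)  (yes vc) _        _        = ⊥-elim (between ab bc ac a≢c v≢b va vc vb)
    go _        _        (yes vd) (no ve)  = ⊥-elim (between de ea da d≢a v≢e vd va ve)
    go _        (yes vc) (no vd)  (yes ve) = ⊥-elim (between cd de ce c≢e v≢d vc ve vd)
    go (yes vb) (no vc)  (yes vd) _        = ⊥-elim (between bc cd bd b≢d v≢c vb vd vc)
    go (yes vb) _        (no vd)  (no ve)  = ⊥-elim (no-2K₂ vb de vd ve bd (eb ∘ Adj-sym))
    go (no vb)  (no vc)  _        (yes ve) = ⊥-elim (no-2K₂ ve bc vb vc eb (ce ∘ Adj-sym))
    go _        (no vc)  (no vd)  _        = ⊥-elim (no-2K₂ va cd vc vd ac (da ∘ Adj-sym))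

lookup-injective : ∀ {A : Set} {xs : List A} → Unique xs → Injective _≡_ _≡_ (lookup xs)
lookup-injective (x∉xs ∷ᵘ uniq) {zero}  {zero}  _  = refl
lookup-injective (x∉xs ∷ᵘ uniq) {zero}  {suc j} eq = contradiction eq (All.lookup x∉xs (∈-lookup j))
lookup-injective (x∉xs ∷ᵘ uniq) {suc i} {zero}  eq = contradiction (sym eq) (All.lookup x∉xs (∈-lookup i))
lookup-injective (x∉xs ∷ᵘ uniq) {suc i} {suc j} eq = cong suc (lookup-injective uniq eq)

-- Colourings from the chromatic number, and the split case

module _ {n : ℕ} (G : FinGraph n) {ℓ : ℕ} (ℓ≥χ+1 : ℓ ≥ χ G + 1) where
  open FinGraph G
  open Reconfiguration G ℓ

  χ-colouring : Colouring G (χ G)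
  χ-colouring = proj₁ (proj₂ (chromaticNumber G))

  χ<ℓ : χ G < ℓ
  χ<ℓ = ≤-trans (≤-reflexive (+-comm 1 (χ G))) ℓ≥χ+1

  -- Connectedness includes that there is a colouring at all.
  a-colouring : Colouring G ℓ
  a-colouring = colouring (λ v → inject≤ (colour χ-colouring v) χ≤ℓ) λ u v uv eq →
    proper χ-colouring u v uv (inject≤-injective χ≤ℓ χ≤ℓ _ _ eq)
    where
    χ≤ℓ : χ G ≤ ℓ
    χ≤ℓ = <⇒≤ χ<ℓ

  -- There is one class per clique vertex, hence at most `χ G` of them. Clique vertices keep their
  -- colour, so only independent vertices change.
  split-normalForm : Split G → NormalForm
  split-normalForm S = record
    { w<ℓ       = ≤-trans (s≤s (injective⇒≤ (clique-colours G isClique χ-colouring))) χ<ℓ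
    ; class     = missed
    ; separates = separates
    ; normalise = λ α → colour α ∘ clique , clique-colours G isClique α ,
        within-mono _ (count-≤n λ v → ¬? (colour α v ≟ colour α (clique (missed v))))
          (recolour-independent α _ λ u v uv → Sum.map (cong (colour α)) (cong (colour α)) (cover uv))
    }
    where
    open Split S

    -- By `cover` one end of the edge is its own missed clique vertex; with equal `missed` values
    -- the other end would see the vertex that it misses.
    separates : ∀ {u v} → Adj u v → missed u ≢ missed v
    separates {u} {v} uv eq with cover uv
    ... | inj₁ u≡ = misses v (subst (Adj v) (trans u≡ (cong clique eq)) (Adj-sym uv))
    ... | inj₂ v≡ = misses u (subst (Adj u) (trans v≡ (cong clique (sym eq))) uv)

-- The five-cycle case

module PseudoSplit {n : ℕ} (G : FinGraph n) (2K₂-free : (2K₂ -free) G) (C₄-free : (C₄ -free) G)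
                   {a b c d e : Fin n} (C : FiveCycle G a b c d e) where
  open FinGraph G
  open Structure G 2K₂-free C₄-free
  open FiveCycle C

  Complete : Fin n → Set
  Complete v = Adj v a × Adj v b × Adj v c × Adj v d × Adj v e

  complete? : U.Decidable Complete
  complete? v = Adj? v a ×-dec Adj? v b ×-dec Adj? v c ×-dec Adj? v d ×-dec Adj? v e

  Anticomplete : Fin n → Set
  Anticomplete v = ¬ Adj v a × ¬ Adj v b × ¬ Adj v c × ¬ Adj v d × ¬ Adj v e

  -- If not adjacent, `u` and `v` would induce a `C₄` with the non-adjacent `a` and `c`.
  complete-adjacent : ∀ {u v} → Complete u → Complete v → u ≢ v → Adj u v
  complete-adjacent {u} {v} (ua , _ , uc , _) (va , _ , vc , _) u≢v =
    decidable-stable (Adj? u v) λ uv → no-C₄ ua (Adj-sym va) vc (Adj-sym uc) uv ac u≢v a≢c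

  completes : List (Fin n)
  completes = filter complete? (allFin n)

  m : ℕ
  m = length completes

  K : Fin m → Fin n
  K = lookup completes

  K-complete : ∀ i → Complete (K i)
  K-complete i = proj₂ (∈-filter⁻ complete? {xs = allFin n} (∈-lookup i))

  K-clique : Clique G K
  K-clique {i} {j} i≢j = complete-adjacent (K-complete i) (K-complete j)
    (i≢j ∘ lookup-injective (filter⁺ complete? (allFin⁺ n)))

  -- A relation, so that matching on it reveals a vertex and its class together, without repeating
  -- the decisions made in `role`.
  data Role : Fin n → Fin (3 + m) → Set where
    is-a    : Role a 0F
    is-c    : Role c 0F
    is-anti : ∀ {v} → Anticomplete v → Role v 0F
    is-b    : Role b 1F
    is-d    : Role d 1F
    is-e    : Role e 2F
    is-K    : ∀ i → Role (K i) (suc (suc (suc i)))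

  role : ∀ v → ∃ (Role v)
  role v with v ≟ a | v ≟ b | v ≟ c | v ≟ d | v ≟ e
  ... | yes refl | _ | _ | _ | _ = _ , is-a
  ... | _ | yes refl | _ | _ | _ = _ , is-b
  ... | _ | _ | yes refl | _ | _ = _ , is-c
  ... | _ | _ | _ | yes refl | _ = _ , is-d
  ... | _ | _ | _ | _ | yes refl = _ , is-e
  ... | no v≢a | no v≢b | no v≢c | no v≢d | no v≢e with Adj? v a
  ...   | yes va = _ , subst (λ u → Role u (suc (suc (suc (index v∈))))) (sym (lookup-index v∈)) (is-K (index v∈))
    where
    v∈ : v ∈ completes
    v∈ = ∈-filter⁺ complete? (∈-allFin v) (va , sees-all C v≢b v≢c v≢d v≢e va)
  -- Seeing any other vertex of the cycle would, by `sees-all` for the rotation that starts there,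
  -- entail seeing `a`.
  ...   | no ¬va = _ , is-anti
    ( ¬va
    , (λ vb → ¬va (proj₂ (proj₂ (proj₂ (sees-all C′ v≢c v≢d v≢e v≢a vb)))))
    , (λ vc → ¬va (proj₁ (proj₂ (proj₂ (sees-all C′′ v≢d v≢e v≢a v≢b vc)))))
    , (λ vd → ¬va (proj₁ (proj₂ (sees-all C′′′ v≢e v≢a v≢b v≢c vd))))
    , (λ ve → ¬va (proj₁ (sees-all C′′′′ v≢a v≢b v≢c v≢d ve))))
    where
    C′    = rotate G C
    C′′   = rotate G C′
    C′′′  = rotate G C′′
    C′′′′ = rotate G C′′′

  class : Fin n → Fin (3 + m)
  class = proj₁ ∘ role

  same-class : ∀ {u v k} → Role u k → Role v k → ¬ Adj u v
  same-class is-a is-a = Adj-irrefl refl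
  same-class is-a is-c = ac
  same-class is-a (is-anti (va , _)) = va ∘ Adj-sym
  same-class is-c is-a = ac ∘ Adj-sym
  same-class is-c is-c = Adj-irrefl refl
  same-class is-c (is-anti (_ , _ , vc , _)) = vc ∘ Adj-sym
  same-class (is-anti (ua , _)) is-a = ua
  same-class (is-anti (_ , _ , uc , _)) is-c = uc
  -- Two adjacent anticomplete vertices would induce a `2K₂` with the edge from `a` to `b`.
  same-class (is-anti (ua , ub , _)) (is-anti (va , vb , _)) uv = no-2K₂ uv ab ua ub va vb
  same-class is-b is-b = Adj-irrefl refl
  same-class is-b is-d = bd
  same-class is-d is-b = bd ∘ Adj-sym
  same-class is-d is-d = Adj-irrefl refl
  same-class is-e is-e = Adj-irrefl refl
  same-class (is-K i) (is-K .i) = Adj-irrefl refl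

  separates : ∀ {u v} → Adj u v → class u ≢ class v
  separates {u} {v} uv eq =
    same-class (subst (Role u) eq (proj₂ (role u))) (proj₂ (role v)) uv

  -- Three cycle vertices have distinct colours: `a`, `b`, `c` or `b`, `c`, `d`, unless `a` agrees
  -- with `c` and `b` with `d`; then `e`, which sees `a` and `d`, differs from both `a` and `b`. The
  -- clique `K`, complete to the cycle, brings `m` further colours.
  3+m≤ : ∀ {k} → Colouring G k → 3 + m ≤ k
  3+m≤ {k} γ = go (colour γ a ≟ colour γ c) (colour γ b ≟ colour γ d)
    where
    γ-≢ : ∀ {u v} → Adj u v → colour γ u ≢ colour γ v
    γ-≢ = proper γ _ _

    K~a = proj₁ ∘ K-complete
    K~b = proj₁ ∘ proj₂ ∘ K-complete
    K~c = proj₁ ∘ proj₂ ∘ proj₂ ∘ K-complete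
    K~d = proj₁ ∘ proj₂ ∘ proj₂ ∘ proj₂ ∘ K-complete
    K~e = proj₂ ∘ proj₂ ∘ proj₂ ∘ proj₂ ∘ K-complete

    rainbow : ∀ {x y z} → colour γ x ≢ colour γ y → colour γ x ≢ colour γ z → colour γ y ≢ colour γ z →
              (∀ i → Adj (K i) x) → (∀ i → Adj (K i) y) → (∀ i → Adj (K i) z) → 3 + m ≤ k
    rainbow x≢y x≢z y≢z K~x K~y K~z = injective⇒≤
      (∷-injective (λ { zero → x≢y ; (suc zero) → x≢z ; (suc (suc i)) → ≢-sym (γ-≢ (K~x i)) })
        (∷-injective (λ { zero → y≢z ; (suc i) → ≢-sym (γ-≢ (K~y i)) })
          (∷-injective (λ i → ≢-sym (γ-≢ (K~z i))) (clique-colours G K-clique γ))))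

    go : Dec (colour γ a ≡ colour γ c) → Dec (colour γ b ≡ colour γ d) → 3 + m ≤ k
    go (no a≢c)  _         = rainbow (γ-≢ ab) a≢c (γ-≢ bc) K~a K~b K~c
    go (yes _)   (no b≢d)  = rainbow (γ-≢ bc) b≢d (γ-≢ cd) K~b K~c K~d
    go (yes _)   (yes b≡d) = rainbow (γ-≢ ab) (≢-sym (γ-≢ ea)) (γ-≢ de ∘ trans (sym b≡d)) K~a K~b K~e

  module _ {ℓ : ℕ} (ℓ≥χ+1 : ℓ ≥ χ G + 1) where
    open Reconfiguration G ℓ
    open Classes class separates

    3+m<ℓ : 3 + m < ℓ
    3+m<ℓ = ≤-trans (s≤s (3+m≤ (χ-colouring G ℓ≥χ+1))) (χ<ℓ G ℓ≥χ+1)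

    -- Class 0 is first recoloured with a colour f that is used neither on b, d, e nor on K;
    -- then b has no neighbour left with the colour of d and can receive it.
    module Normalise (α : Colouring G ℓ) where

      -- The colour of `b` takes the slot of class 0, so that the `3 + m` slots cover all colours to
      -- be avoided and `3+m<ℓ` leaves one over.
      others : Fin (3 + m) → Fin ℓ
      others = colour α b ∷ colour α d ∷ colour α e ∷ colour α ∘ K

      f : Fin ℓ
      f = proj₁ (fresh 3+m<ℓ others)

      others≢f : ∀ i → others i ≢ f
      others≢f = proj₂ (fresh 3+m<ℓ others)

      palette : Fin (3 + m) → Fin ℓ
      palette = f ∷ colour α d ∷ colour α e ∷ colour α ∘ K

      palette-injective : Injective _≡_ _≡_ palette
      palette-injective =
        ∷-injective (λ i → ≢-sym (others≢f (suc i)))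
          (∷-injective (λ { zero → proper α _ _ de
                          ; (suc i) → ≢-sym (proper α _ _ (proj₁ (proj₂ (proj₂ (proj₂ (K-complete i)))))) })
            (∷-injective (λ i → ≢-sym (proper α _ _ (proj₂ (proj₂ (proj₂ (proj₂ (K-complete i)))))))
              (clique-colours G K-clique α)))

      role-≢f : ∀ {v k} → Role v (suc k) → colour α v ≢ f
      role-≢f is-b     = others≢f 0F
      role-≢f is-d     = others≢f 1F
      role-≢f is-e     = others≢f 2F
      role-≢f (is-K i) = others≢f (suc (suc (suc i)))

      replace₀ : Fin (3 + m) → Fin ℓ → Fin ℓ
      replace₀ zero    _ = f
      replace₀ (suc _) x = x

      halfway : Fin n → Fin ℓ
      halfway v = replace₀ (class v) (colour α v)

      halfway-proper : Proper G halfway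
      halfway-proper u v uv = go (proj₂ (role u)) (proj₂ (role v))
        where
        go : ∀ {i j} → Role u i → Role v j → replace₀ i (colour α u) ≢ replace₀ j (colour α v)
        go {zero}  {zero}  ru rv _ = same-class ru rv uv
        go {zero}  {suc _} _  rv   = ≢-sym (role-≢f rv)
        go {suc _} {zero}  ru _    = role-≢f ru
        go {suc _} {suc _} _  _    = proper α u v uv

      β : Colouring G ℓ
      β = colouring halfway halfway-proper

      γ : Colouring G ℓ
      γ = paint palette palette-injective

      α-β-independent : IndependentChange α β
      α-β-independent u v uv = go (proj₂ (role u)) (proj₂ (role v))
        where
        go : ∀ {i j} → Role u i → Role v j →
             colour α u ≡ replace₀ i (colour α u) ⊎ colour α v ≡ replace₀ j (colour α v)
        go {zero}  {zero}  ru rv = contradiction uv (same-class ru rv)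
        go {suc _} {_}     _  _  = inj₁ refl
        go {zero}  {suc _} _  _  = inj₂ refl

      -- Class 0 has reached its final colour `f`, and `d`, `e` and `K` keep their colours of `α` in
      -- the palette.
      only-b : ∀ {v k} → Role v k → v ≡ b ⊎ replace₀ k (colour α v) ≡ palette k
      only-b is-a        = inj₂ refl
      only-b is-c        = inj₂ refl
      only-b (is-anti _) = inj₂ refl
      only-b is-b        = inj₁ refl
      only-b is-d        = inj₂ refl
      only-b is-e        = inj₂ refl
      only-b (is-K _)    = inj₂ refl

      β-γ-independent : IndependentChange β γ
      β-γ-independent u v uv = go (only-b (proj₂ (role u))) (only-b (proj₂ (role v)))
        where
        go : {P Q : Set} → u ≡ b ⊎ P → v ≡ b ⊎ Q → P ⊎ Q
        go (inj₂ same) _           = inj₁ same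
        go (inj₁ _)    (inj₂ same) = inj₂ same
        go (inj₁ u≡b)  (inj₁ v≡b)  = contradiction uv (Adj-irrefl (trans u≡b (sym v≡b)))

      -- Class 0 is final after the first stage, and the other classes are untouched by it. As no
      -- vertex changes twice, both stages together cost at most `n`.
      changed-once : ∀ k {x} → x ≢ replace₀ k x → ¬ replace₀ k x ≢ palette k
      changed-once zero    _  ne = ne refl
      changed-once (suc _) ne _  = ne refl

      α⇝γ : Within α γ n
      α⇝γ = within-mono _ cost (within-++ _ (recolour-independent α β α-β-independent)
                                            (recolour-independent β γ β-γ-independent))
        where
        cost : differences (colour α) halfway + differences halfway (palette ∘ class) ≤ n
        cost = ≤-trans
          (count-disjoint (λ v → ¬? (colour α v ≟ halfway v)) (λ v → ¬? (halfway v ≟ palette (class v)))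
            U? _ _ (λ v → changed-once (class v)))
          (count-≤n {P = U.U} U?)

    pseudoSplit-normalForm : NormalForm
    pseudoSplit-normalForm = record
      { w<ℓ       = 3+m<ℓ
      ; class     = class
      ; separates = separates
      ; normalise = λ α → let open Normalise α in palette , palette-injective , α⇝γ
      }

theorem7 : ∀ {n : ℕ} (G : FinGraph n) → (2K₂ -free) G → (C₄ -free) G →
    ∀ (ℓ : ℕ) → ℓ ≥ χ G + 1 →
    Connected (ReconfigurationGraph G ℓ) × DiameterAtMost (ReconfigurationGraph G ℓ) (4 * n)
theorem7 {n} G 2K₂-free C₄-free ℓ ℓ≥χ+1 =
  (a-colouring G ℓ≥χ+1 , λ α β → map₂ proj₂ (within α β)) , diameterAtMost within
  where
  open Reconfiguration G ℓ

  normalForm : NormalForm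
  normalForm with Structure.split-or-fiveCycle G 2K₂-free C₄-free
  ... | inj₁ split = split-normalForm G ℓ≥χ+1 split
  ... | inj₂ (_ , _ , _ , _ , _ , C) = PseudoSplit.pseudoSplit-normalForm G 2K₂-free C₄-free C ℓ≥χ+1

  within : ∀ α β → Within α β (4 * n)
  within = within-4n normalForm
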